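{- For every natural number $n \geq 2$, there exists a regular graph $G_n$ with $\chi(G_n) = n = \gamma(G_n)$.
   Context: All graphs are finite and simple; $\chi$ denotes chromatic number. A set $D \subseteq V(G)$ is a total dominating set of $G$ if every vertex of $V(G)$ is adjacent to some vertex of $D$. Define $\gamma(G) := \min\{\chi(G[D]) : D \text{ a total dominating set of } G\}$, where $G[D]$ is the subgraph induced by $D$. -}

module Defs where

open import Data.Fin.Base using (Fin)
open import Data.Fin.Subset using (Subset; _∈_; ∣_∣)
open import Data.Nat.Base using (ℕ; _≤_)
open import Data.Product.Base using (Σ-syntax; ∃; ∃-syntax; _×_; proj₁)
open import Data.Vec.Base using (tabulate)
open import Function.Base using (_on_)
open import Level using (0ℓ)
open import Relation.Binary.Core using (Rel)
open import Relation.Binary.Definitions using (Decidable; Irreflexive; Symmetric)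
open import Relation.Binary.PropositionalEquality using (_≡_; _≢_; refl)
open import Relation.Nullary.Decidable using (does)

-- Finiteness is not part of this record: a finite graph is a SimpleGraph (Fin m).
-- General vertex types are allowed so that an induced subgraph can have its
-- vertex set as its vertex type.
record SimpleGraph (V : Set) : Set₁ where
  field
    Adj    : Rel V 0ℓ
    adj?   : Decidable Adj
    sym    : Symmetric Adj
    irrefl : Irreflexive _≡_ Adj

open SimpleGraph public using (Adj; adj?)

IsMinimum : (ℕ → Set) → ℕ → Set
IsMinimum P k = P k × (∀ j → P j → k ≤ j)

Colourable : ∀ {V} → SimpleGraph V → ℕ → Set
Colourable {V} G k =
  Σ[ c ∈ (V → Fin k) ] (∀ {u v} → Adj G u v → c u ≢ c v)

-- χ and γ are rendered as functional relations: "Isχ G k" reads "χ(G) = k".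
Isχ : ∀ {V} → SimpleGraph V → ℕ → Set
Isχ G = IsMinimum (Colourable G)

module _ {m : ℕ} (G : SimpleGraph (Fin m)) where

  neighbourhood : Fin m → Subset m
  neighbourhood v = tabulate λ w → does (adj? G v w)

  degree : Fin m → ℕ
  degree v = ∣ neighbourhood v ∣

  Regular : Set
  Regular = ∃[ d ] ∀ v → degree v ≡ d

  TotalDominating : Subset m → Set
  TotalDominating D = ∀ v → ∃[ u ] u ∈ D × Adj G v u

  induced : (D : Subset m) → SimpleGraph (∃ λ v → v ∈ D)
  induced D = record
    { Adj    = Adj G on proj₁
    ; adj?   = λ u v → adj? G (proj₁ u) (proj₁ v)
    ; sym    = SimpleGraph.sym G
    ; irrefl = λ { refl → SimpleGraph.irrefl G refl }
    }

  -- No k satisfies Isγ when G has an isolated vertex: there is then no total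
  -- dominating set.
  Isγ : ℕ → Set
  Isγ = IsMinimum λ k → ∃[ D ] TotalDominating D × Isχ (induced D) k

{-# OPTIONS --safe #-}

-- Write n = k + 1. Take disjoint n-cliques, one for each point p ∈ [n]^n, and
-- call i ∈ [n] the colour of the i-th vertex of a clique. For each colour i and
-- each choice of one point from every hyperplane { p : p i = a }, add a hub
-- joined to the i-th vertices of the n chosen cliques. If a set D meets all
-- neighbourhoods of hubs of colour i, then it contains the i-th vertices of all
-- cliques over some hyperplane { p : p i = a i }, since otherwise the hub that
-- chooses a missed point in each hyperplane has no neighbour in D. Hence D
-- contains the whole clique at the point (a 0, …, a k). The colours, with any
-- colour other than i on a hub of colour i, give a proper colouring.
--
-- A clique vertex lies in N = ∣[n]^k∣^k neighbourhoods of hubs. Replacing each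
-- clique vertex by N independent copies preserves the argument, and all degrees
-- become n N: hubs have n neighbours with N copies each, and clique vertices
-- have (n - 1) N clique neighbours and N hub neighbours.
module Submission where

open import Data.Bool.Base using (true)
open import Data.Empty using (⊥)
open import Data.Fin.Base using (Fin; zero; suc; punchIn)
open import Data.Fin.Properties
  using (_≟_; any?; ¬∀⟶∃¬; injective⇒≤; suc-injective; punchInᵢ≢i; +↔⊎; *↔×)
open import Data.Fin.Subset using (Subset; inside; outside; _∈_; ∣_∣; ⊤)
open import Data.Fin.Subset.Properties using (_∈?_; ∈⊤)
open import Data.Nat.Base using (ℕ; zero; suc; _^_; _≤_; _≥_; s≤s)
open import Data.Nat.Properties using (≤-antisym)
open import Data.Product.Base using (∃; ∃-syntax; Σ-syntax; _×_; _,_; proj₁; proj₂)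
open import Data.Product.Function.NonDependent.Propositional using (_×-↔_)
open import Data.Sum.Base using (_⊎_; inj₁; inj₂)
open import Data.Sum.Function.Propositional using (_⊎-↔_)
open import Data.Vec.Base
  using (Vec; []; _∷_; here; there; head; tail; lookup; tabulate; replicate; insertAt; removeAt)
open import Data.Vec.Properties
  using (≡-dec; lookup∘tabulate; []=⇒lookup; lookup⇒[]=; insertAt-lookup;
         removeAt-insertAt; insertAt-removeAt)
open import Function.Base using (_∘_)
open import Function.Bundles using (_↔_; mk↔ₛ′; module Inverse)
open import Function.Construct.Composition using (_↔-∘_)
open import Function.Construct.Identity using (↔-id)
open import Level using (0ℓ)
open import Relation.Binary.Core using (Rel)
open import Relation.Binary.Definitions using (Decidable)
open import Relation.Binary.PropositionalEquality
open import Relation.Nullary.Decidable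
  using (Dec; yes; no; does; map′; ¬?; _×-dec_; decidable-stable; dec-true)
open import Relation.Nullary.Negation using (¬_; contradiction)
import Relation.Unary as U
open import Defs

private variable
  A : Set
  m n : ℕ

-- Finite types and cardinalities of subsets.

Vec↔ : ∀ k → Fin m ↔ A → Fin (m ^ k) ↔ Vec A k
Vec↔ zero    e = mk↔ₛ′ (λ _ → []) (λ _ → zero) (λ { [] → refl }) (λ { zero → refl })
Vec↔ (suc k) e = cons ↔-∘ ((e ×-↔ Vec↔ k e) ↔-∘ *↔×)
  where
  cons : ∀ {A n} → (A × Vec A n) ↔ Vec A (suc n)
  cons = mk↔ₛ′ (λ (x , xs) → x ∷ xs) (λ xs → head xs , tail xs)
               (λ { (x ∷ xs) → refl }) (λ _ → refl)

∃?-↔ : Fin m ↔ A → {P : U.Pred A 0ℓ} → U.Decidable P → Dec (∃ P)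
∃?-↔ e {P} P? = map′ (λ (i , p) → to i , p)
  (λ (x , p) → from x , subst P (sym (strictlyInverseˡ x)) p) (any? (P? ∘ to))
  where open Inverse e

element : (p : Subset m) → Fin ∣ p ∣ → Fin m
element (inside  ∷ p) zero    = zero
element (inside  ∷ p) (suc i) = suc (element p i)
element (outside ∷ p) i       = suc (element p i)

element-∈ : (p : Subset m) (i : Fin ∣ p ∣) → element p i ∈ p
element-∈ (inside  ∷ p) zero    = here
element-∈ (inside  ∷ p) (suc i) = there (element-∈ p i)
element-∈ (outside ∷ p) i       = there (element-∈ p i)

element-injective : (p : Subset m) {i j : Fin ∣ p ∣} → element p i ≡ element p j → i ≡ j
element-injective (inside  ∷ p) {zero}  {zero}  _  = refl
element-injective (inside  ∷ p) {suc _} {suc _} eq =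
  cong suc (element-injective p (suc-injective eq))
element-injective (outside ∷ p) eq = element-injective p (suc-injective eq)

element-surjective : (p : Subset m) {v : Fin m} → v ∈ p → ∃[ i ] element p i ≡ v
element-surjective (inside  ∷ p) here      = zero , refl
element-surjective (inside  ∷ p) (there h) with i , eq ← element-surjective p h = suc i , cong suc eq
element-surjective (outside ∷ p) (there h) with i , eq ← element-surjective p h = i , cong suc eq

-- Since `element` lists the members of `p` without repetition, `f` and `f⁻¹` yield injections both
-- ways. Off `p`, `f⁻¹` may take junk values.
∣p∣≡ : (p : Subset m) (f : Fin n → Fin m) (f⁻¹ : Fin m → Fin n) →
       (∀ i → f i ∈ p) → (∀ i → f⁻¹ (f i) ≡ i) → (∀ {v} → v ∈ p → f (f⁻¹ v) ≡ v) →
       ∣ p ∣ ≡ n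
∣p∣≡ p f f⁻¹ f∈p left right = ≤-antisym (injective⇒≤ there-inj) (injective⇒≤ back-inj)
  where
  there-inj : ∀ {i j} → f⁻¹ (element p i) ≡ f⁻¹ (element p j) → i ≡ j
  there-inj {i} {j} eq = element-injective p
    (trans (sym (right (element-∈ p i))) (trans (cong f eq) (right (element-∈ p j))))

  index : Fin _ → Fin ∣ p ∣
  index i = proj₁ (element-surjective p (f∈p i))

  element-index : ∀ i → element p (index i) ≡ f i
  element-index i = proj₂ (element-surjective p (f∈p i))

  back-inj : ∀ {i j} → index i ≡ index j → i ≡ j
  back-inj {i} {j} eq = trans (sym (left i)) (trans (cong f⁻¹ f-eq) (left j))
    where f-eq = trans (sym (element-index i)) (trans (cong (element p) eq) (element-index j))

module _ {P : U.Pred (Fin m) 0ℓ} (P? : U.Decidable P) where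

  ∈-tabulate⁺ : ∀ {v} → P v → v ∈ tabulate (does ∘ P?)
  ∈-tabulate⁺ {v} p = lookup⇒[]= v _ (trans (lookup∘tabulate (does ∘ P?) v) (dec-true (P? v) p))

  ∈-tabulate⁻ : ∀ {v} → v ∈ tabulate (does ∘ P?) → P v
  ∈-tabulate⁻ {v} v∈ = holds (P? v) (trans (sym (lookup∘tabulate (does ∘ P?) v)) ([]=⇒lookup v∈))
    where
    holds : ∀ {Q : Set} (Q? : Dec Q) → does Q? ≡ true → Q
    holds (yes q) _ = q

-- Cliques, hubs and adjacency.

transport : Fin m ↔ A → SimpleGraph A → SimpleGraph (Fin m)
transport e G = record
  { Adj    = λ u v → Adj G (to u) (to v)
  ; adj?   = λ u v → adj? G (to u) (to v)
  ; sym    = SimpleGraph.sym G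
  ; irrefl = λ { refl → SimpleGraph.irrefl G refl }
  }
  where open Inverse e

-- n = k + 1 = l + 2
module Construction (l : ℕ) where

  k #colours : ℕ
  k = suc l
  #colours = suc k

  -- `Reduced` stands for a point of a hyperplane with its fixed coordinate omitted. `Label` indexes
  -- the N copies; it has the form of a hub's choices in k hyperplanes, so that a label can name a
  -- hub at a given clique vertex.
  Colour Reduced Point Label Vertex : Set
  Colour  = Fin #colours
  Reduced = Vec Colour k
  Point   = Vec Colour #colours
  Label   = Vec Reduced k
  Vertex  = (Point × Colour × Label) ⊎ (Colour × Vec Reduced #colours)

  pattern clique p i g = inj₁ (p , i , g)
  -- The hub of colour i that chooses in the hyperplane { p : p i = a } the point
  -- with remaining coordinates given by the a-th entry of b.
  pattern hub i b      = inj₂ (i , b)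

  Reduced↔ : Fin _ ↔ Reduced
  Reduced↔ = Vec↔ k (↔-id _)

  Label↔ : Fin _ ↔ Label
  Label↔ = Vec↔ k Reduced↔

  Vertex↔ : Fin _ ↔ Vertex
  Vertex↔ = (cliques ⊎-↔ hubs) ↔-∘ +↔⊎
    where
    cliques : Fin _ ↔ (Point × Colour × Label)
    cliques = (Vec↔ #colours (↔-id _) ×-↔ ((↔-id _ ×-↔ Label↔) ↔-∘ *↔×)) ↔-∘ *↔×

    hubs : Fin _ ↔ (Colour × Vec Reduced #colours)
    hubs = (↔-id _ ×-↔ Vec↔ #colours Reduced↔) ↔-∘ *↔×

  Degree↔ : Fin _ ↔ (Colour × Label)
  Degree↔ = (↔-id _ ×-↔ Label↔) ↔-∘ *↔×

  -- The value `lookup p i` selects the hyperplane through `p`; the hub's choice there must be `p`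
  -- itself.
  Joined : Point → Colour → Colour → Vec Reduced #colours → Set
  Joined p i j b = i ≡ j × lookup b (lookup p i) ≡ removeAt p i

  joined? : ∀ p i j b → Dec (Joined p i j b)
  joined? p i j b = (i ≟ j) ×-dec ≡-dec _≟_ _ _

  _~_ : Rel Vertex 0ℓ
  clique p i _ ~ clique q j _ = p ≡ q × i ≢ j
  clique p i _ ~ hub j b      = Joined p i j b
  hub j b      ~ clique p i _ = Joined p i j b
  hub _ _      ~ hub _ _      = ⊥

  _~?_ : Decidable _~_
  clique p i _ ~? clique q j _ = ≡-dec _≟_ p q ×-dec ¬? (i ≟ j)
  clique p i _ ~? hub j b      = joined? p i j b
  hub j b      ~? clique p i _ = joined? p i j b
  hub _ _      ~? hub _ _      = no λ ()

  ~-sym : ∀ {u v} → u ~ v → v ~ u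
  ~-sym {clique _ _ _} {clique _ _ _} (p≡q , i≢j) = sym p≡q , i≢j ∘ sym
  ~-sym {clique _ _ _} {hub _ _}      h           = h
  ~-sym {hub _ _}      {clique _ _ _} h           = h

  ~-irrefl : ∀ {u} → ¬ u ~ u
  ~-irrefl {clique _ _ _} (_ , i≢i) = i≢i refl

  -- Regularity: neighbourhoods enumerated by `Colour × Label`.

  neighbour : Vertex → Colour × Label → Vertex
  neighbour (clique p i g) (j , h) with i ≟ j
  -- A clique vertex has no clique neighbour of its own colour, so these pairs are free to encode
  -- hubs: the choice in the hyperplane through `p` is forced, and `h` supplies the other k.
  ... | yes _ = hub i (insertAt h (lookup p i) (removeAt p i))
  ... | no  _ = clique p j h
  neighbour (hub i b) (a , h) = clique (insertAt (lookup b a) i a) i h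

  -- The clause for two hubs, which are never adjacent, is junk.
  neighbour⁻¹ : Vertex → Vertex → Colour × Label
  neighbour⁻¹ (clique p i _) (clique q j h) = j , h
  neighbour⁻¹ (clique p i _) (hub j b)      = i , removeAt b (lookup p i)
  neighbour⁻¹ (hub i b)      (clique q j h) = lookup q i , h
  neighbour⁻¹ (hub _ _)      (hub i _)      = i , replicate _ (replicate _ zero)

  ~neighbour : ∀ u x → u ~ neighbour u x
  ~neighbour (clique p i g) (j , h) with i ≟ j
  ... | yes _  = refl , insertAt-lookup h (lookup p i) (removeAt p i)
  ... | no i≢j = refl , i≢j
  ~neighbour (hub i b) (a , h) = refl ,
    trans (cong (lookup b) (insertAt-lookup (lookup b a) i a))
          (sym (removeAt-insertAt (lookup b a) i a))

  neighbour-inverseˡ : ∀ u x → neighbour⁻¹ u (neighbour u x) ≡ x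
  neighbour-inverseˡ (clique p i g) (j , h) with i ≟ j
  ... | yes refl = cong (i ,_) (removeAt-insertAt h (lookup p i) (removeAt p i))
  ... | no _     = refl
  neighbour-inverseˡ (hub i b) (a , h) = cong (_, h) (insertAt-lookup (lookup b a) i a)

  neighbour-inverseʳ : ∀ u v → u ~ v → neighbour u (neighbour⁻¹ u v) ≡ v
  neighbour-inverseʳ (clique p i g) (clique .p j h) (refl , i≢j) with i ≟ j
  ... | yes i≡j = contradiction i≡j i≢j
  ... | no _    = refl
  neighbour-inverseʳ (clique p i g) (hub .i b) (refl , eq) with i ≟ i
  ... | no i≢i = contradiction refl i≢i
  ... | yes _  = cong (hub i) (trans (cong (insertAt _ (lookup p i)) (sym eq))
                                     (insertAt-removeAt b (lookup p i)))
  neighbour-inverseʳ (hub i b) (clique q .i h) (refl , eq) =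
    cong (λ q → clique q i h) (trans (cong (λ r → insertAt r i (lookup q i)) eq)
                                     (insertAt-removeAt q i))

  open Inverse Vertex↔ using (to; from; strictlyInverseˡ; strictlyInverseʳ)
  module Deg = Inverse Degree↔

  G : SimpleGraph (Fin _)
  G = transport Vertex↔ record
    { Adj = _~_ ; adj? = _~?_ ; sym = ~-sym ; irrefl = λ { refl → ~-irrefl } }

  ~⇒Adj : ∀ {u v} → u ~ v → Adj G (from u) (from v)
  ~⇒Adj = subst₂ _~_ (sym (strictlyInverseˡ _)) (sym (strictlyInverseˡ _))

  regular : Regular G
  regular = _ , λ v → ∣p∣≡ (neighbourhood G v)
    (λ x → from (neighbour (to v) (Deg.to x)))
    (λ w → Deg.from (neighbour⁻¹ (to v) (to w)))
    (λ x → ∈-tabulate⁺ (adj? G v)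
      (subst (to v ~_) (sym (strictlyInverseˡ _)) (~neighbour (to v) (Deg.to x))))
    (λ x → trans
      (cong Deg.from (trans (cong (neighbour⁻¹ (to v)) (strictlyInverseˡ _))
                            (neighbour-inverseˡ (to v) (Deg.to x))))
      (Deg.strictlyInverseʳ x))
    (λ {w} w∈ → trans
      (cong from (trans (cong (neighbour (to v)) (Deg.strictlyInverseˡ _))
                        (neighbour-inverseʳ (to v) (to w) (∈-tabulate⁻ (adj? G v) w∈))))
      (strictlyInverseʳ w))

  -- The proper colouring.

  colour : Vertex → Colour
  colour (clique _ i _) = i
  -- `zero : Fin k` exists because n ≥ 2.
  colour (hub i _)      = punchIn i zero

  colour-proper : ∀ {u v} → u ~ v → colour u ≢ colour v
  colour-proper {clique _ _ _} {clique _ _ _} (_ , i≢j)  = i≢j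
  colour-proper {clique _ i _} {hub _ _}      (refl , _) = punchInᵢ≢i i zero ∘ sym
  colour-proper {hub _ _}      {clique _ i _} (refl , _) = punchInᵢ≢i i zero

  colourable : Colourable G #colours
  colourable = colour ∘ to , colour-proper

  -- Lower bound for total dominating sets.

  module _ {D : Subset _} (dominating : TotalDominating G D) where

    -- One copy suffices, since all copies of a clique vertex have the same neighbours.
    Hit : Colour → Point → Set
    Hit i p = ∃[ g ] from (clique p i g) ∈ D

    hit? : ∀ i p → Dec (Hit i p)
    hit? i p = ∃?-↔ Label↔ (λ g → from (clique p i g) ∈? D)

    Missed : Colour → Colour → Set
    Missed i a = ∃[ r ] ¬ Hit i (insertAt r i a)

    missed? : ∀ i a → Dec (Missed i a)
    missed? i a = ∃?-↔ Reduced↔ (λ r → ¬? (hit? i (insertAt r i a)))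

    ¬all-missed : ∀ i → ¬ (∀ a → Missed i a)
    ¬all-missed i missed =
      undominated (to u) (subst (_~ to u) (strictlyInverseˡ h) h~u) (from-to∈ u∈D)
      where
      h : Vertex
      h = hub i (tabulate (proj₁ ∘ missed))

      u   = proj₁ (dominating (from h))
      u∈D = proj₁ (proj₂ (dominating (from h)))
      h~u = proj₂ (proj₂ (dominating (from h)))

      from-to∈ : ∀ {v} → v ∈ D → from (to v) ∈ D
      from-to∈ {v} = subst (_∈ D) (sym (strictlyInverseʳ v))

      -- A neighbour of `h` lies over the point missed in its own hyperplane, none of whose copies
      -- of colour `i` is in `D`.
      undominated : ∀ v → h ~ v → ¬ from v ∈ D
      undominated (clique p .i g) (refl , eq) v∈D =
        proj₂ (missed a) (g , subst (λ q → from (clique q i g) ∈ D) p≡ v∈D)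
        where
        a  = lookup p i
        p≡ : p ≡ insertAt (proj₁ (missed a)) i a
        p≡ = trans (sym (insertAt-removeAt p i)) (cong (λ r → insertAt r i a)
               (trans (sym eq) (lookup∘tabulate (proj₁ ∘ missed) a)))

    unmissed : ∀ i → ∃[ a ] ¬ Missed i a
    unmissed i = ¬∀⟶∃¬ _ (Missed i) (missed? i) (¬all-missed i)

    centre : Point
    centre = tabulate (proj₁ ∘ unmissed)

    -- Coordinate `i` of `centre` is a value whose hyperplane has no point missed in colour `i`, and
    -- `centre` lies in that hyperplane.
    centre-hit : ∀ i → Hit i centre
    centre-hit i = decidable-stable (hit? i centre) λ ¬hit → proj₂ (unmissed i)
      (removeAt centre i , ¬hit ∘ subst (Hit i) (trans
        (cong (insertAt _ i) (sym (lookup∘tabulate (proj₁ ∘ unmissed) i)))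
        (insertAt-removeAt centre i)))

    -- The hit copies over `centre`, one of each colour, form an n-clique in `D`.
    induced-lower-bound : ∀ c → Colourable (induced G D) c → #colours ≤ c
    induced-lower-bound c (f , proper) = injective⇒≤ {f = f ∘ vertex} injective
      where
      vertex : Colour → ∃ (_∈ D)
      vertex i = from (clique centre i (proj₁ (centre-hit i))) , proj₂ (centre-hit i)

      injective : ∀ {i j} → f (vertex i) ≡ f (vertex j) → i ≡ j
      injective {i} {j} eq = decidable-stable (i ≟ j) λ i≢j →
        proper {vertex i} {vertex j}
          (~⇒Adj {clique centre i (proj₁ (centre-hit i))}
                 {clique centre j (proj₁ (centre-hit j))} (refl , i≢j)) eq

  -- The values of χ and γ.

  restrict : ∀ {c} D → Colourable G c → Colourable (induced G D) c
  restrict D (f , proper) = f ∘ proj₁ , proper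

  ⊤-dominating : TotalDominating G ⊤
  ⊤-dominating v = from w , ∈⊤ , subst (to v ~_) (sym (strictlyInverseˡ w)) (~neighbour (to v) _)
    where w = neighbour (to v) (zero , replicate _ (replicate _ zero))

  -- The lower bound is the case `D = ⊤` of the bound for total dominating sets.
  isχ : Isχ G #colours
  isχ = colourable , λ c → induced-lower-bound ⊤-dominating c ∘ restrict ⊤

  isγ : Isγ G #colours
  isγ = (⊤ , ⊤-dominating , restrict ⊤ colourable , induced-lower-bound ⊤-dominating)
      , λ c (D , dominating , colouring , _) → induced-lower-bound dominating c colouring

theorem1p4 : (n : ℕ) → n ≥ 2 →
    ∃[ m ] Σ[ G ∈ SimpleGraph (Fin m) ] (Regular G × Isχ G n × Isγ G n)
theorem1p4 (suc zero) (s≤s ())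
theorem1p4 (suc (suc l)) _ = _ , G , regular , isχ , isγ
  where open Construction l
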